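{- Let $H=(V_H,E_H)$ be a graph, $S_H\subset V_H$ a stable set in $H$ and $f_H: V_H \to \mathbb{N}$ a function. Suppose: 1. $H$ is $([f_H,k], S_H)$-critical for some $k\geq \max\left (\max_{v\in V_H}f_H(v),\ \max_{v\in S_H}(f_H(v)+1)\right )$. 2. For this $k$, every list assignment $L_H$ of $H$ with lists contained in $\{1,\dots,k\}$ and satisfying the following conditions is feasible: $|L_H(v)|=f_H(v)$ for all $v\in V_H\setminus S_H$, and there is a color $c$ such that $L_H(v)=\{c\}$ for all $v\in S_H$. Let $G=(V,E)$ be a graph (vertex-disjoint from $H$), $f: V \to \mathbb{N}$ and $v_0\in V$ with $\max_{v\in V}f(v)\leq k$ and $f(v_0)\leq k-1$. Let $G'=(V_H\cup V, E')$ be the graph obtained by adding $H$ to $G$ (disjoint union) and linking every vertex of $S_H$ to $v_0$ by an edge, and let $f': V_H\cup V \to \mathbb{N}$ be defined by $f'(v)=f_H(v)+1$ for $v\in S_H$, $f'(v_0)=f(v_0)+1$, $f'(v)=f_H(v)$ for $v\in V_H\setminus S_H$, and $f'(v)=f(v)$ for $v\in V\setminus \{v_0\}$. Then $G'$ is $[f',k]$-choosable if and only if $G$ is $[f,k]$-choosable.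
   Context: All graphs are finite and simple. A stable set is a set of pairwise non-adjacent vertices. For a graph $G=(V,E)$ and $f:V\to\mathbb N$, an $f$-list assignment is an assignment $L$ of lists with $|L(v)|=f(v)$ for all $v\in V$. A list assignment $L$ is feasible if there is a proper coloring $c$ of $G$ with $c(v)\in L(v)$ for all $v$, and infeasible otherwise. For $k\ge\max_v f(v)$, $G$ is $[f,k]$-choosable if every $f$-list assignment with lists contained in $\{1,\dots,k\}$ is feasible. For $V'\subset V$, $G$ is $([f,k],V')$-critical if (a) there is an infeasible $f$-list assignment $L$ with $L(v)\subset\{1,\dots,k\}$ for all $v\in V$ and $\left|\bigcup_{v\in V'}L(v)\right|\leq k-1$, and (b) for every vertex $v\in V'$, if $f(v)$ is replaced by $f(v)+1$ (all other values of $f$ unchanged), then for the resulting function $\hat f$ the graph $G$ is $[\hat f,k]$-choosable. -}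

module Defs where

open import Data.Bool.Base using (if_then_else_)
open import Data.Fin.Base using (Fin)
open import Data.Fin.Properties using (+↔⊎; inj⇒≟)
open import Data.Fin.Subset using (Subset; _∈_; ∣_∣; ⋃; ⁅_⁆)
open import Data.List.Base using (List; map; filter; allFin)
open import Data.Nat.Base using (ℕ; suc; _+_; _<_)
open import Data.Product.Base using (_×_; _,_; ∃)
open import Data.Sum.Base using (_⊎_; inj₁; inj₂; [_,_]′)
open import Data.Sum.Function.Propositional using (_⊎-↔_)
open import Function.Bundles using (_↔_; Inverse)
open import Function.Properties.Inverse using (↔-sym; ↔-trans; ↔⇒↣)
open import Level using (0ℓ)
open import Relation.Binary.Core using (Rel)
import Relation.Binary.Definitions as B
open import Relation.Binary.PropositionalEquality using (_≡_; _≢_)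
open import Relation.Nullary using (¬_; does; _×-dec_)
open import Relation.Unary using (Pred; Decidable)

record Graph : Set₁ where
  field
    V           : Set
    order       : ℕ
    enumeration : V ↔ Fin order
    Adj         : Rel V 0ℓ
    adj?        : B.Decidable Adj
    adj-sym     : B.Symmetric Adj
    adj-irrefl  : B.Irreflexive _≡_ Adj

  vertices : List V
  vertices = map (Inverse.from enumeration) (allFin order)

  _≟_ : B.DecidableEquality V
  _≟_ = inj⇒≟ (↔⇒↣ enumeration)

open Graph public using (V)

Stable : (G : Graph) → Pred (V G) 0ℓ → Set
Stable G S = ∀ {u v} → S u → S v → ¬ Graph.Adj G u v

-- The colours 1, …, k are represented by the k elements of Fin k.
ListAssignment : Graph → ℕ → Set
ListAssignment G k = V G → Subset k

HasSizes : (G : Graph) → (V G → ℕ) → ∀ {k} → ListAssignment G k → Set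
HasSizes G f L = ∀ v → ∣ L v ∣ ≡ f v

Proper : (G : Graph) → ∀ {k} → (V G → Fin k) → Set
Proper G c = ∀ {u v} → Graph.Adj G u v → c u ≢ c v

Feasible : (G : Graph) → ∀ {k} → ListAssignment G k → Set
Feasible G {k} L = ∃ λ (c : V G → Fin k) → Proper G c × (∀ v → c v ∈ L v)

-- Only meaningful when f v ≤ k for all v; otherwise it holds vacuously.
Choosable : (G : Graph) → (V G → ℕ) → ℕ → Set
Choosable G f k = (L : ListAssignment G k) → HasSizes G f L → Feasible G L

raiseOn : {A : Set} {P : Pred A 0ℓ} → Decidable P → (A → ℕ) → A → ℕ
raiseOn P? f v = if does (P? v) then f v + 1 else f v

raiseAt : (G : Graph) → V G → (V G → ℕ) → V G → ℕ
raiseAt G u = raiseOn (λ v → Graph._≟_ G v u)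

unionOver : (G : Graph) {S : Pred (V G) 0ℓ} → Decidable S →
            ∀ {k} → ListAssignment G k → Subset k
unionOver G S? L = ⋃ (map L (filter S? (Graph.vertices G)))

-- The bound "at most k − 1" is written "< k", since truncated subtraction
-- would give a different condition for k = 0.
Critical : (G : Graph) → (V G → ℕ) → ℕ → {S : Pred (V G) 0ℓ} → Decidable S → Set
Critical G f k {S} S? =
    (∃ λ (L : ListAssignment G k) →
       HasSizes G f L × ¬ Feasible G L × ∣ unionOver G S? L ∣ < k)
  × (∀ v → S v → Choosable G (raiseAt G v f) k)

FeasibleWithCommonSingleton : (H : Graph) → (V H → ℕ) → ℕ → Pred (V H) 0ℓ → Set
FeasibleWithCommonSingleton H f k S =
  (L : ListAssignment H k) →
  (∀ v → ¬ S v → ∣ L v ∣ ≡ f v) →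
  (∃ λ (c : Fin k) → ∀ v → S v → L v ≡ ⁅ c ⁆) →
  Feasible H L

module _ (H : Graph) {S : Pred (V H) 0ℓ} (S? : Decidable S)
         (G : Graph) (v₀ : V G) where

  private
    module H = Graph H
    module G = Graph G

    Adj : Rel (H.V ⊎ G.V) 0ℓ
    Adj (inj₁ x) (inj₁ y) = H.Adj x y
    Adj (inj₁ x) (inj₂ v) = S x × v ≡ v₀
    Adj (inj₂ v) (inj₁ x) = S x × v ≡ v₀
    Adj (inj₂ u) (inj₂ v) = G.Adj u v

    adj? : B.Decidable Adj
    adj? (inj₁ x) (inj₁ y) = H.adj? x y
    adj? (inj₁ x) (inj₂ v) = S? x ×-dec (v G.≟ v₀)
    adj? (inj₂ v) (inj₁ x) = S? x ×-dec (v G.≟ v₀)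
    adj? (inj₂ u) (inj₂ v) = G.adj? u v

    adj-sym : B.Symmetric Adj
    adj-sym {inj₁ _} {inj₁ _} e = H.adj-sym e
    adj-sym {inj₁ _} {inj₂ _} e = e
    adj-sym {inj₂ _} {inj₁ _} e = e
    adj-sym {inj₂ _} {inj₂ _} e = G.adj-sym e

    adj-irrefl : B.Irreflexive _≡_ Adj
    adj-irrefl {inj₁ _} _≡_.refl e = H.adj-irrefl _≡_.refl e
    adj-irrefl {inj₂ _} _≡_.refl e = G.adj-irrefl _≡_.refl e

  attach : Graph
  attach = record
    { V           = H.V ⊎ G.V
    ; order       = H.order + G.order
    ; enumeration = ↔-trans (H.enumeration ⊎-↔ G.enumeration) (↔-sym +↔⊎)
    ; Adj         = Adj
    ; adj?        = adj?
    ; adj-sym     = λ {x} {y} → adj-sym {x} {y}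
    ; adj-irrefl  = adj-irrefl
    }

  attachSizes : (H.V → ℕ) → (G.V → ℕ) → H.V ⊎ G.V → ℕ
  attachSizes fH f = [ raiseOn S? fH , raiseAt G v₀ f ]′

{-# OPTIONS --safe #-}

-- From right to left: deleting a colour c from the lists on S leaves H
-- infeasible for at most one c.  Indeed criticality forces such a c into every
-- list on S, so for a second such colour c′ the colouring of H that is constantly
-- c on S avoids c′.  Deleting that one exceptional colour from the list of v₀
-- before colouring G ensures that the colouring extends to H.
--
-- From left to right: rename the colours of the infeasible assignment of H so
-- that a colour c missing from the list of v₀ is also missing from all lists on
-- S, and insert c into all these lists.  A colouring with v₀ coloured c would
-- colour H from its infeasible lists, so v₀ gets a colour of its original list.
module Submission where

open import Defs
open import Data.Bool.Base using (Bool; true; false; if_then_else_)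
open import Data.Fin.Base using (Fin; zero; suc; fromℕ<; finToFun; funToFin)
import Data.Fin.Properties as Fin
open import Data.Fin.Permutation using (Permutation′; _⟨$⟩ʳ_; transpose)
open import Data.Fin.Subset using (Subset; inside; outside; _∈_; _∉_; _⊆_; ∣_∣; ⋃; ⁅_⁆; _∪_; _-_; ⊥; ⊤)
open import Data.Fin.Subset.Properties
open import Data.List.Base using (List; _∷_)
open import Data.List.Membership.Propositional using () renaming (_∈_ to _∈ˡ_)
open import Data.List.Membership.Propositional.Properties using (∈-map⁺; ∈-filter⁺; ∈-allFin)
open import Data.List.Relation.Unary.Any using (here; there)
open import Data.Nat.Base using (ℕ; zero; suc; _+_; _^_; _≤_; _<_; z≤n; s≤s)
import Data.Nat.Properties as ℕ
open import Data.Product.Base using (_×_; _,_; ∃; proj₁; proj₂)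
open import Data.Sum.Base using (inj₁; inj₂; [_,_]′)
open import Data.Vec.Base using (_∷_; here; there; tabulate; lookup)
open import Data.Vec.Properties using (lookup∘tabulate; tabulate∘lookup; []=⇒lookup; lookup⇒[]=)
open import Function.Base using (_∘_; _$_)
open import Function.Bundles using (_⇔_; mk⇔; Inverse; Injection)
open import Function.Properties.Inverse using (↔⇒↣)
open import Level using (0ℓ)
open import Relation.Binary.PropositionalEquality
open import Relation.Nullary using (Dec; yes; no; ¬_; ¬?; contradiction; _×-dec_; _→-dec_; map′)
open import Relation.Nullary.Decidable using (decidable-stable; dec-true; dec-false)
open import Relation.Unary using (Pred; Decidable)

private
  variable
    A : Set
    P : Pred A 0ℓ
    k n : ℕ
    c d : Fin n
    p : Subset n

x∉p-x : ∀ (p : Subset n) x → x ∉ p - x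
x∉p-x (inside  ∷ p) (suc x) (there x∈) = x∉p-x p x x∈
x∉p-x (outside ∷ p) (suc x) (there x∈) = x∉p-x p x x∈

∣p∣≤1+∣p-x∣ : ∀ (p : Subset n) x → ∣ p ∣ ≤ suc ∣ p - x ∣
∣p∣≤1+∣p-x∣ (inside  ∷ p) zero    = s≤s (ℕ.≤-reflexive (cong ∣_∣ (sym (p─⊥≡p p))))
∣p∣≤1+∣p-x∣ (outside ∷ p) zero    = ℕ.m≤n⇒m≤1+n (ℕ.≤-reflexive (cong ∣_∣ (sym (p─⊥≡p p))))
∣p∣≤1+∣p-x∣ (inside  ∷ p) (suc x) = s≤s (∣p∣≤1+∣p-x∣ p x)
∣p∣≤1+∣p-x∣ (outside ∷ p) (suc x) = ∣p∣≤1+∣p-x∣ p x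

x∉p⇒∣p∣<∣p∪⁅x⁆∣ : c ∉ p → ∣ p ∣ < ∣ p ∪ ⁅ c ⁆ ∣
x∉p⇒∣p∣<∣p∪⁅x⁆∣ {c = c} {p = p} c∉p =
  p⊂q⇒∣p∣<∣q∣ (p⊆p∪q ⁅ c ⁆ , c , q⊆p∪q p ⁅ c ⁆ (x∈⁅x⁆ c) , c∉p)

x∈p∪⁅y⁆∧x≢y⇒x∈p : c ∈ p ∪ ⁅ d ⁆ → c ≢ d → c ∈ p
x∈p∪⁅y⁆∧x≢y⇒x∈p {p = p} {d = d} c∈ c≢d with x∈p∪q⁻ p ⁅ d ⁆ c∈
... | inj₁ c∈p = c∈p
... | inj₂ c∈d = contradiction (x∈⁅y⁆⇒x≡y d c∈d) c≢d

∣p∣<n⇒∃x∉p : (p : Subset n) → ∣ p ∣ < n → ∃ λ x → x ∉ p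
∣p∣<n⇒∃x∉p {n} p ∣p∣<n = Fin.¬∀⟶∃¬ n (_∈ p) (_∈? p) λ all →
  ℕ.<⇒≱ ∣p∣<n (subst (_≤ ∣ p ∣) (∣⊤∣≡n n) (p⊆q⇒∣p∣≤∣q∣ {p = ⊤} λ {x} _ → all x))

shrink : ∀ m (p : Subset n) → m ≤ ∣ p ∣ → ∃ λ q → q ⊆ p × ∣ q ∣ ≡ m
shrink {n} zero p _ = ⊥ , ⊆-min p , ∣⊥∣≡0 n
shrink (suc m) (outside ∷ p) 1+m≤∣p∣ with shrink (suc m) p 1+m≤∣p∣
... | q , q⊆p , eq = outside ∷ q , s⊆s q⊆p , eq
shrink (suc m) (inside ∷ p) (s≤s m≤∣p∣) with shrink m p m≤∣p∣
... | q , q⊆p , eq = inside ∷ q , s⊆s q⊆p , cong suc eq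

p∈ps⇒p⊆⋃ps : ∀ {ps : List (Subset n)} → p ∈ˡ ps → p ⊆ ⋃ ps
p∈ps⇒p⊆⋃ps {ps = _ ∷ ps} (here refl) = p⊆p∪q (⋃ ps)
p∈ps⇒p⊆⋃ps {ps = q ∷ ps} (there p∈)  = ⊆-trans (p∈ps⇒p⊆⋃ps p∈) (q⊆p∪q q (⋃ ps))

preimage : Permutation′ n → Subset n → Subset n
preimage π p = tabulate (lookup p ∘ (π ⟨$⟩ʳ_))

∈-preimage⁻ : ∀ π (p : Subset n) → c ∈ preimage π p → (π ⟨$⟩ʳ c) ∈ p
∈-preimage⁻ π p c∈ =
  lookup⇒[]= _ p (trans (sym (lookup∘tabulate (lookup p ∘ (π ⟨$⟩ʳ_)) _)) ([]=⇒lookup c∈))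

∣preimage∣ : ∀ π (p : Subset n) → ∣ preimage π p ∣ ≡ ∣ p ∣
∣preimage∣ π p = begin
  ∣ preimage π p ∣                       ≡⟨ ∣tabulate∣ (lookup p ∘ (π ⟨$⟩ʳ_)) ⟩
  sum (indicator ∘ lookup p ∘ (π ⟨$⟩ʳ_)) ≡⟨ sum-permute (indicator ∘ lookup p) π ⟨
  sum (indicator ∘ lookup p)             ≡⟨ ∣tabulate∣ (lookup p) ⟨
  ∣ tabulate (lookup p) ∣                ≡⟨ cong ∣_∣ (tabulate∘lookup p) ⟩
  ∣ p ∣                                  ∎
  where
  open ≡-Reasoning
  open import Algebra.Properties.CommutativeMonoid.Sum ℕ.+-0-commutativeMonoid using (sum; sum-permute)

  indicator : Bool → ℕ
  indicator b = if b then 1 else 0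

  ∣tabulate∣ : ∀ {n} (g : Fin n → Bool) → ∣ tabulate g ∣ ≡ sum (indicator ∘ g)
  ∣tabulate∣ {zero}  g = refl
  ∣tabulate∣ {suc n} g with g zero
  ... | true  = cong suc (∣tabulate∣ (g ∘ suc))
  ... | false = ∣tabulate∣ (g ∘ suc)

raiseOn-∈ : (P? : Decidable P) (f : A → ℕ) {v : A} → P v → raiseOn P? f v ≡ suc (f v)
raiseOn-∈ P? f {v} Pv rewrite dec-true (P? v) Pv = ℕ.+-comm (f v) 1

raiseOn-∉ : (P? : Decidable P) (f : A → ℕ) {v : A} → ¬ P v → raiseOn P? f v ≡ f v
raiseOn-∉ P? f {v} ¬Pv rewrite dec-false (P? v) ¬Pv = refl

deleteOn insertOn : {P : Pred A 0ℓ} → Decidable P → Fin k → (A → Subset k) → A → Subset k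
deleteOn P? c L v with P? v
... | yes _ = L v - c
... | no  _ = L v
insertOn P? c L v with P? v
... | yes _ = L v ∪ ⁅ c ⁆
... | no  _ = L v

module _ {P : Pred A 0ℓ} (P? : Decidable P) (L : A → Subset k) where

  ∈-deleteOn⁺ : ∀ v → d ∈ L v → (P v → d ≢ c) → d ∈ deleteOn P? c L v
  ∈-deleteOn⁺ v d∈ d≢c with P? v
  ... | yes Pv = x∈p∧x≢y⇒x∈p-y d∈ (d≢c Pv)
  ... | no  _  = d∈

  ∈-deleteOn⁻ : ∀ v → d ∈ deleteOn P? c L v → d ∈ L v × (P v → d ≢ c)
  ∈-deleteOn⁻ {d = d} v d∈ with P? v
  ... | yes Pv = p─q⊆p (L v) _ d∈ , λ { _ refl → x∉p-x (L v) d d∈ }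
  ... | no ¬Pv = d∈ , λ Pv → contradiction Pv ¬Pv

  ∈-insertOn⁻ : ∀ v → d ∈ insertOn P? c L v → (P v → d ≢ c) → d ∈ L v
  ∈-insertOn⁻ v d∈ d≢c with P? v
  ... | yes Pv = x∈p∪⁅y⁆∧x≢y⇒x∈p d∈ (d≢c Pv)
  ... | no  _  = d∈

  ∣deleteOn∣ : ∀ (f : A → ℕ) c v → ∣ L v ∣ ≡ raiseOn P? f v → f v ≤ ∣ deleteOn P? c L v ∣
  ∣deleteOn∣ f c v eq with P? v
  ... | yes _ = ℕ.≤-pred $ begin
    suc (f v)         ≡⟨ ℕ.+-comm 1 (f v) ⟩
    f v + 1           ≡⟨ eq ⟨
    ∣ L v ∣           ≤⟨ ∣p∣≤1+∣p-x∣ (L v) c ⟩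
    suc ∣ L v - c ∣   ∎
    where open ℕ.≤-Reasoning
  ... | no  _ = ℕ.≤-reflexive (sym eq)

  ∣insertOn∣ : ∀ (f : A → ℕ) v → ∣ L v ∣ ≡ f v → (P v → c ∉ L v) →
               raiseOn P? f v ≤ ∣ insertOn P? c L v ∣
  ∣insertOn∣ f v eq c∉ with P? v
  ... | yes Pv = begin
    f v + 1           ≡⟨ ℕ.+-comm (f v) 1 ⟩
    suc (f v)         ≡⟨ cong suc eq ⟨
    suc ∣ L v ∣       ≤⟨ x∉p⇒∣p∣<∣p∪⁅x⁆∣ (c∉ Pv) ⟩
    ∣ L v ∪ ⁅ _ ⁆ ∣   ∎
    where open ℕ.≤-Reasoning
  ... | no  _  = ℕ.≤-reflexive (sym eq)

module _ (G : Graph) where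
  private module G = Graph G
  open Inverse G.enumeration using (to; from; strictlyInverseʳ)

  allV? : {Q : Pred G.V 0ℓ} → Decidable Q → Dec (∀ v → Q v)
  allV? {Q} Q? = map′ (λ q v → subst Q (strictlyInverseʳ v) (q (to v))) (λ q i → q (from i))
                      (Fin.all? (Q? ∘ from))

  feasible? : (L : ListAssignment G k) → Dec (Feasible G L)
  feasible? {k} L = map′ (λ (i , colours) → decode i , colours) encode
    (Fin.any? λ i → proper? (decode i) ×-dec allV? λ v → decode i v ∈? L v)
    where
    decode : Fin (k ^ G.order) → G.V → Fin k
    decode i v = finToFun i (to v)

    proper? : (φ : G.V → Fin k) → Dec (Proper G φ)
    proper? φ = map′ (λ h {u} {v} → h u v) (λ h u v → h)
      (allV? λ u → allV? λ v → G.adj? u v →-dec ¬? (φ u Fin.≟ φ v))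

    encode : Feasible G L → ∃ λ i → Proper G (decode i) × (∀ v → decode i v ∈ L v)
    encode (φ , proper , φ∈L) = i ,
        (λ {u} {v} e eq → proper e (trans (sym (decode-i u)) (trans eq (decode-i v)))) ,
        (λ v → subst (_∈ L v) (sym (decode-i v)) (φ∈L v))
      where
      i = funToFin (φ ∘ from)

      decode-i : ∀ v → decode i v ≡ φ v
      decode-i v = trans (Fin.finToFun-funToFin (φ ∘ from) (to v)) (cong φ (strictlyInverseʳ v))

  Choosable-≥ : ∀ {f} → Choosable G f k → (L : ListAssignment G k) →
                (∀ v → f v ≤ ∣ L v ∣) → Feasible G L
  Choosable-≥ choosable L f≤∣L∣ =
    let sublist v = shrink _ (L v) (f≤∣L∣ v)
        φ , proper , φ∈ = choosable (proj₁ ∘ sublist) (proj₂ ∘ proj₂ ∘ sublist)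
    in φ , proper , λ v → proj₁ (proj₂ (sublist v)) (φ∈ v)

  Feasible-preimage : ∀ π (L : ListAssignment G k) → Feasible G (preimage π ∘ L) → Feasible G L
  Feasible-preimage π L (φ , proper , φ∈) =
    (π ⟨$⟩ʳ_) ∘ φ ,
    (λ e → proper e ∘ Injection.injective (↔⇒↣ π)) ,
    (λ v → ∈-preimage⁻ π (L v) (φ∈ v))

  ⊆-unionOver : {S : Pred G.V 0ℓ} (S? : Decidable S) (L : ListAssignment G k) →
                ∀ {v} → S v → L v ⊆ unionOver G S? L
  ⊆-unionOver S? L {v} Sv = p∈ps⇒p⊆⋃ps (∈-map⁺ L (∈-filter⁺ S? v∈vertices Sv))
    where
    v∈vertices : v ∈ˡ G.vertices
    v∈vertices = subst (_∈ˡ G.vertices) (strictlyInverseʳ v) (∈-map⁺ from (∈-allFin (to v)))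

module _ (H : Graph) {S : Pred (V H) 0ℓ} (S? : Decidable S) (fH : V H → ℕ) where

  private module H = Graph H

  infeasibleAvoiding : Critical H fH k S? → (c : Fin k) →
    ∃ λ (L : ListAssignment H k) →
      HasSizes H fH L × ¬ Feasible H L × (∀ v → S v → c ∉ L v)
  infeasibleAvoiding ((L , sizes , infeasible , small) , _) c
    with d , d∉ ← ∣p∣<n⇒∃x∉p (unionOver H S? L) small =
      preimage π ∘ L ,
      (λ v → trans (∣preimage∣ π (L v)) (sizes v)) ,
      infeasible ∘ Feasible-preimage H π L ,
      λ v Sv c∈ → d∉ (⊆-unionOver H S? L Sv (subst (_∈ L v) πc≡d (∈-preimage⁻ π (L v) c∈)))
    where
    π = transpose c d

    πc≡d : π ⟨$⟩ʳ c ≡ d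
    πc≡d rewrite dec-true (c Fin.≟ c) refl = refl

  module _ (crit : Critical H fH k S?) (L : ListAssignment H k)
           (sizes : HasSizes H (raiseOn S? fH) L) where

    infeasible-deleteOn⇒∈ : ¬ Feasible H (deleteOn S? c L) → ∀ {v} → S v → c ∈ L v
    infeasible-deleteOn⇒∈ {c = c} infeasible {v} Sv = decidable-stable (c ∈? L v) λ c∉ →
      infeasible (Choosable-≥ H (proj₂ crit v Sv) (deleteOn S? c L) (large c∉))
      where
      large : c ∉ L v → ∀ u → raiseAt H v fH u ≤ ∣ deleteOn S? c L u ∣
      large c∉ u with u H.≟ v
      ... | no u≢v = begin
        raiseAt H v fH u        ≡⟨ raiseOn-∉ (H._≟ v) fH u≢v ⟩
        fH u                    ≤⟨ ∣deleteOn∣ S? L fH _ u (sizes u) ⟩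
        ∣ deleteOn S? _ L u ∣   ∎
        where open ℕ.≤-Reasoning
      ... | yes refl = begin
        raiseAt H v fH v        ≡⟨ raiseOn-∈ (H._≟ v) fH refl ⟩
        suc (fH v)              ≡⟨ raiseOn-∈ S? fH Sv ⟨
        raiseOn S? fH v         ≡⟨ sizes v ⟨
        ∣ L v ∣                 ≤⟨ p⊆q⇒∣p∣≤∣q∣ (λ d∈ → ∈-deleteOn⁺ S? L v d∈ λ { _ refl → c∉ d∈ }) ⟩
        ∣ deleteOn S? c L v ∣   ∎
        where open ℕ.≤-Reasoning

    infeasible-deleteOn-unique : FeasibleWithCommonSingleton H fH k S →
      ¬ Feasible H (deleteOn S? c L) → ¬ Feasible H (deleteOn S? d L) → c ≡ d
    infeasible-deleteOn-unique {c = c} {d = d} common ¬c ¬d =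
      decidable-stable (c Fin.≟ d) λ c≢d →
        let φ , proper , φ∈ = common M sizeM (c , λ v → M-∈)
        in ¬d (φ , proper , λ v → M⊆ c≢d v (φ∈ v))
      where
      M : ListAssignment H _
      M v with S? v
      ... | yes _ = ⁅ c ⁆
      ... | no  _ = L v

      M-∈ : ∀ {v} → S v → M v ≡ ⁅ c ⁆
      M-∈ {v} Sv with S? v
      ... | yes _  = refl
      ... | no ¬Sv = contradiction Sv ¬Sv

      sizeM : ∀ v → ¬ S v → ∣ M v ∣ ≡ fH v
      sizeM v ¬Sv with S? v | sizes v
      ... | yes Sv | _  = contradiction Sv ¬Sv
      ... | no  _  | eq = eq

      M⊆ : c ≢ d → ∀ v → M v ⊆ deleteOn S? d L v
      M⊆ c≢d v x∈ with S? v
      ... | no  _  = x∈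
      ... | yes Sv with refl ← x∈⁅y⁆⇒x≡y c x∈ =
        x∈p∧x≢y⇒x∈p-y (infeasible-deleteOn⇒∈ ¬c Sv) c≢d

    exceptionalColour : FeasibleWithCommonSingleton H fH k S → Fin k →
      ∃ λ d → ∀ c → c ≢ d → Feasible H (deleteOn S? c L)
    exceptionalColour common c₀
      with Fin.any? (λ d → ¬? (feasible? H (deleteOn S? d L)))
    ... | yes (d , ¬d) = d , λ c c≢d → decidable-stable (feasible? H _) λ ¬c →
            c≢d (infeasible-deleteOn-unique common ¬c ¬d)
    ... | no none = c₀ , λ c _ → decidable-stable (feasible? H _) λ ¬c → none (c , ¬c)

lemma4 : (H : Graph) (S : Pred (V H) 0ℓ) (S? : Decidable S) → Stable H S →
    (fH : V H → ℕ) (k : ℕ) →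
    (∀ v → fH v ≤ k) → (∀ v → S v → fH v + 1 ≤ k) →
    Critical H fH k S? →
    FeasibleWithCommonSingleton H fH k S →
    (G : Graph) (f : V G → ℕ) (v₀ : V G) →
    (∀ v → f v ≤ k) → f v₀ < k →
    Choosable (attach H S? G v₀) (attachSizes H S? G v₀ fH f) k ⇔ Choosable G f k
lemma4 H S S? _ fH k _ _ crit common G f v₀ _ fv₀<k = mk⇔ detach extend
  where
  at? : Decidable (_≡ v₀)
  at? v = Graph._≟_ G v v₀

  G′ : Graph
  G′ = attach H S? G v₀

  f′ : V G′ → ℕ
  f′ = attachSizes H S? G v₀ fH f

  detach : Choosable G′ f′ k → Choosable G f k
  detach choosable L sizes
    with c , c∉ ← ∣p∣<n⇒∃x∉p (L v₀) (subst (_< k) (sym (sizes v₀)) fv₀<k)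
    with LH , sizesH , infeasible , avoids ← infeasibleAvoiding H S? fH crit c
    with φ , proper , φ∈ ← Choosable-≥ G′ choosable
           [ insertOn S? c LH , insertOn at? c L ]′
           (λ { (inj₁ x) → ∣insertOn∣ S? LH fH x (sizesH x) (avoids x)
              ; (inj₂ v) → ∣insertOn∣ at? L f v (sizes v) λ { refl → c∉ } })
    = φ ∘ inj₂ , (λ {u} {v} → proper {inj₂ u} {inj₂ v}) ,
      λ v → ∈-insertOn⁻ at? L v (φ∈ (inj₂ v)) λ { refl → φv₀≢c }
    where
    φv₀≢c : φ (inj₂ v₀) ≢ c
    φv₀≢c φv₀≡c = infeasible
      (φ ∘ inj₁ , (λ {x} {y} → proper {inj₁ x} {inj₁ y}) ,
       λ x → ∈-insertOn⁻ S? LH x (φ∈ (inj₁ x)) λ Sx φx≡c →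
         proper {inj₁ x} {inj₂ v₀} (Sx , refl) (trans φx≡c (sym φv₀≡c)))

  extend : Choosable G f k → Choosable G′ f′ k
  extend choosable L sizes
    with d , feasible ← exceptionalColour H S? fH crit (L ∘ inj₁) (sizes ∘ inj₁)
                          common (fromℕ< fv₀<k)
    with φ , properG , φ∈ ← Choosable-≥ G choosable (deleteOn at? d (L ∘ inj₂))
           (λ v → ∣deleteOn∣ at? (L ∘ inj₂) f d v (sizes (inj₂ v)))
    with ψ , properH , ψ∈ ← feasible (φ v₀)
           (proj₂ (∈-deleteOn⁻ at? (L ∘ inj₂) v₀ (φ∈ v₀)) refl)
    = χ , (λ {x} {y} → proper x y) ,
      (λ { (inj₁ x) → proj₁ (∈-deleteOn⁻ S? (L ∘ inj₁) x (ψ∈ x))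
         ; (inj₂ v) → proj₁ (∈-deleteOn⁻ at? (L ∘ inj₂) v (φ∈ v)) })
    where
    χ : V G′ → Fin k
    χ = [ ψ , φ ]′

    ψ≢φv₀ : ∀ {x} → S x → ψ x ≢ φ v₀
    ψ≢φv₀ {x} = proj₂ (∈-deleteOn⁻ S? (L ∘ inj₁) x (ψ∈ x))

    proper : ∀ x y → Graph.Adj G′ x y → χ x ≢ χ y
    proper (inj₁ _) (inj₁ _) e           = properH e
    proper (inj₁ _) (inj₂ _) (Sx , refl) = ψ≢φv₀ Sx
    proper (inj₂ _) (inj₁ _) (Sx , refl) = ψ≢φv₀ Sx ∘ sym
    proper (inj₂ _) (inj₂ _) e           = properG e
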